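{- Let $k$ be a positive integer and let $\mathbb{F}_q$ be the finite field with $q$ elements. If $q>k^3$, then every element of $\mathbb{F}_q$ can be written as a sum of three $k$-th powers of elements of $\mathbb{F}_q$.
   Context: The element $0=0^k$ counts as a $k$-th power. -}

module Defs where

open import Algebra.Apartness.Bundles using (HeytingField; HeytingCommutativeRing)
open import Algebra.Bundles using (CommutativeRing)
open import Data.Fin.Base using (Fin)
open import Data.Nat.Base using (ℕ)
open import Data.Product.Base using (∃-syntax)
open import Function.Bundles using (Inverse)
open import Level using (suc; _⊔_)
open import Relation.Binary.PropositionalEquality.Properties as ≡ using ()
import Algebra.Properties.Semiring.Exp as Exp

-- The enumeration makes _≈_ and invertibility decidable, so _#_ coincides with
-- the negation of _≈_ and every nonzero element has an inverse.  The one-element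
-- ring is excluded: there 0# - 0# would be invertible, hence 0# # 0#,
-- contradicting the irreflexivity of _#_.

record FiniteField c ℓ₁ ℓ₂ (q : ℕ) : Set (suc (c ⊔ ℓ₁ ⊔ ℓ₂)) where
  field
    heytingField : HeytingField c ℓ₁ ℓ₂

  open HeytingField heytingField using (heytingCommutativeRing)

  commutativeRing : CommutativeRing c ℓ₁
  commutativeRing = HeytingCommutativeRing.commutativeRing heytingCommutativeRing

  open CommutativeRing commutativeRing public
  open Exp semiring public using (_^_)

  field
    enumeration : Inverse (≡.setoid (Fin q)) setoid

  IsSumOfThreePowers : ℕ → Carrier → Set (c ⊔ ℓ₁)
  IsSumOfThreePowers k x = ∃[ a ] ∃[ b ] ∃[ d ] x ≈ a ^ k + b ^ k + d ^ k

{-# OPTIONS --safe #-}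
module Submission where

-- Let H be the set of nonzero k-th powers, H₀ = H ∪ {0} and m = |H|; the power map
-- has fibres of size at most k, so q - 1 ≤ k m.  If a ≠ 0 is not a sum of three
-- k-th powers, then x ∙ u ≠ a for all x ∈ H₀ × H₀ × H and u ∈ H × H × H, because
-- k-th powers are closed under products.  But a vector x lies on x ∙ u = a for
-- exactly q² of the u, and two distinct vectors do so simultaneously for at most q
-- of them, so the second moment over u of the number of such x bounds the product
-- of the sizes of the two sets: m³ · (m + 1)² m ≤ q³ (q - 1).  This is incompatible
-- with q > k³, which forces m ≥ k², as soon as k ≥ 2.

open import Defs
open import Data.Nat.Base using (ℕ; NonZero; _>_; _^_)
open import Data.Nat.Base using (zero; suc; pred; _+_; _*_; _≤_; _<_; z≤n; s≤s; >-nonZero)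
open import Data.Nat.Properties hiding (_≟_)
open import Data.Nat.Solver using (module +-*-Solver)
open import Data.Nat.ListAction using (sum)
open import Data.Nat.ListAction.Properties using (sum-++)
open import Data.Empty using (⊥-elim)
open import Data.Fin.Base using (Fin; zero; suc)
import Data.Fin.Properties as Fin
open import Data.List.Base using (List; []; _∷_; _++_; map; length; cartesianProduct; tabulate)
open import Data.List.Properties
  using (map-cong; map-++; map-∘; length-tabulate)
open import Data.Product.Base using (∃-syntax; _×_; _,_; proj₁; proj₂)
open import Data.Vec.Base using (Vec; []; _∷_; replicate)
open import Data.Sum.Base using (_⊎_; inj₁; inj₂)
open import Function.Base using (_∘_)
open import Function.Bundles using (module Inverse)
open import Level using (Level)
open import Relation.Binary.PropositionalEquality
  using (_≡_; _≢_; refl; sym; trans; cong; cong₂; subst; module ≡-Reasoning)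
open import Relation.Nullary.Decidable using (Dec; yes; no; map′; _×-dec_; ¬?)
open import Relation.Nullary.Negation using (¬_)
open import Algebra.Apartness.Bundles using (module HeytingField)
import Algebra.Apartness.Properties.HeytingCommutativeRing as HeytingCommutativeRingProperties
import Algebra.Properties.CommutativeSemiring.Exp as Exp
import Algebra.Properties.Ring as RingProperties
import Algebra.Solver.Ring.NaturalCoefficients.Default as SemiringSolver
import Relation.Binary.Reasoning.Setoid as ≈-Reasoning

private variable
  ℓ : Level
  A B : Set ℓ

-- Finite sums of natural numbers over lists.

∑ : List A → (A → ℕ) → ℕ
∑ xs f = sum (map f xs)

∑-cong : {f g : A → ℕ} (xs : List A) → (∀ x → f x ≡ g x) → ∑ xs f ≡ ∑ xs g
∑-cong xs f≗g = cong sum (map-cong f≗g xs)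

∑-mono : {f g : A → ℕ} (xs : List A) → (∀ x → f x ≤ g x) → ∑ xs f ≤ ∑ xs g
∑-mono []       f≤g = z≤n
∑-mono (x ∷ xs) f≤g = +-mono-≤ (f≤g x) (∑-mono xs f≤g)

∑-+ : (xs : List A) (f g : A → ℕ) → ∑ xs (λ x → f x + g x) ≡ ∑ xs f + ∑ xs g
∑-+ []       f g = refl
∑-+ (x ∷ xs) f g rewrite ∑-+ xs f g =
  solve 4 (λ a b c d → (a :+ b) :+ (c :+ d) := (a :+ c) :+ (b :+ d)) refl
    (f x) (g x) (∑ xs f) (∑ xs g)
  where open +-*-Solver

*-∑ : (c : ℕ) (xs : List A) (f : A → ℕ) → c * ∑ xs f ≡ ∑ xs (λ x → c * f x)
*-∑ c []       f = *-zeroʳ c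
*-∑ c (x ∷ xs) f = trans (*-distribˡ-+ c (f x) _) (cong (c * f x +_) (*-∑ c xs f))

∑-* : (xs : List A) (f : A → ℕ) (c : ℕ) → ∑ xs f * c ≡ ∑ xs (λ x → f x * c)
∑-* xs f c = trans (*-comm (∑ xs f) c)
  (trans (*-∑ c xs f) (∑-cong xs λ x → *-comm c (f x)))

∑-const : (xs : List A) (c : ℕ) → ∑ xs (λ _ → c) ≡ length xs * c
∑-const []       c = refl
∑-const (x ∷ xs) c = cong (c +_) (∑-const xs c)

∑-swap : (xs : List A) (ys : List B) (f : A → B → ℕ) →
  ∑ xs (λ x → ∑ ys (f x)) ≡ ∑ ys (λ y → ∑ xs (λ x → f x y))
∑-swap []       ys f = sym (trans (∑-const ys 0) (*-zeroʳ (length ys)))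
∑-swap (x ∷ xs) ys f = trans (cong (∑ ys (f x) +_) (∑-swap xs ys f))
  (sym (∑-+ ys (f x) _))

∑-cartesianProduct : (xs : List A) (ys : List B) (f : A × B → ℕ) →
  ∑ (cartesianProduct xs ys) f ≡ ∑ xs (λ x → ∑ ys (λ y → f (x , y)))
∑-cartesianProduct []       ys f = refl
∑-cartesianProduct (x ∷ xs) ys f = begin
  sum (map f (map (x ,_) ys ++ cartesianProduct xs ys))
    ≡⟨ cong sum (map-++ f (map (x ,_) ys) _) ⟩
  sum (map f (map (x ,_) ys) ++ map f (cartesianProduct xs ys))
    ≡⟨ sum-++ (map f (map (x ,_) ys)) _ ⟩
  sum (map f (map (x ,_) ys)) + ∑ (cartesianProduct xs ys) f
    ≡⟨ cong₂ _+_ (cong sum (sym (map-∘ ys))) (∑-cartesianProduct xs ys f) ⟩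
  ∑ ys (λ y → f (x , y)) + ∑ xs (λ x → ∑ ys (λ y → f (x , y))) ∎
  where open ≡-Reasoning

-- A second-moment inequality for weighted incidences.

-- Lowering `m` and `n` by one takes `2 + 2 * m + 2 * n` off both sides, so simultaneous induction
-- ends where one of them is zero.
2mn≤m²+n² : ∀ m n → 2 * (m * n) ≤ m * m + n * n
2mn≤m²+n² zero    n       = z≤n
2mn≤m²+n² (suc m) zero    rewrite *-zeroʳ m = z≤n
2mn≤m²+n² (suc m) (suc n) = begin
  2 * (suc m * suc n)
    ≡⟨ solve 2 (λ m n → con 2 :* ((con 1 :+ m) :* (con 1 :+ n))
         := con 2 :* (m :* n) :+ (con 2 :+ con 2 :* m :+ con 2 :* n)) refl m n ⟩
  2 * (m * n) + (2 + 2 * m + 2 * n)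
    ≤⟨ +-monoˡ-≤ _ (2mn≤m²+n² m n) ⟩
  m * m + n * n + (2 + 2 * m + 2 * n)
    ≡⟨ solve 2 (λ m n → m :* m :+ n :* n :+ (con 2 :+ con 2 :* m :+ con 2 :* n)
         := (con 1 :+ m) :* (con 1 :+ m) :+ (con 1 :+ n) :* (con 1 :+ n)) refl m n ⟩
  suc m * suc m + suc n * suc n ∎
  where
  open ≤-Reasoning
  open +-*-Solver

module SecondMoment
  (xs : List A) (us : List B) (w : A → ℕ) (v : B → ℕ) (E : A → B → ℕ)
  where

  W : ℕ
  W = ∑ xs w

  weight : B → ℕ
  weight u = ∑ xs (λ x → w x * E x u)

  -- Double counting. The factor `w x` in the hypothesis restricts the degree condition to those `x`
  -- of nonzero weight.
  ∑-weight : (d : ℕ) → (∀ x → w x * ∑ us (E x) ≡ w x * d) → ∑ us weight ≡ W * d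
  ∑-weight d regular = begin
    ∑ us (λ u → ∑ xs (λ x → w x * E x u))  ≡⟨ ∑-swap us xs _ ⟩
    ∑ xs (λ x → ∑ us (λ u → w x * E x u))  ≡⟨ ∑-cong xs (λ x → sym (*-∑ (w x) us (E x))) ⟩
    ∑ xs (λ x → w x * ∑ us (E x))          ≡⟨ ∑-cong xs regular ⟩
    ∑ xs (λ x → w x * d)                   ≡⟨ ∑-* xs w d ⟨
    W * d                                  ∎
    where open ≡-Reasoning

  -- Expanding the square and summing over `us` innermost leaves a weighted sum of codegrees: the
  -- inner sum counts the `u` incident with both `x` and `y`.
  ∑-weight² : ∑ us (λ u → weight u * weight u) ≡
    ∑ xs (λ x → w x * ∑ xs (λ y → w y * ∑ us (λ u → E x u * E y u)))
  ∑-weight² = begin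
    ∑ us (λ u → weight u * weight u)
      ≡⟨ ∑-cong us (λ u → ∑-* xs _ (weight u)) ⟩
    ∑ us (λ u → ∑ xs (λ x → w x * E x u * weight u))
      ≡⟨ ∑-swap us xs _ ⟩
    ∑ xs (λ x → ∑ us (λ u → w x * E x u * weight u))
      ≡⟨ ∑-cong xs (λ x → trans (∑-cong us λ u → *-assoc (w x) (E x u) (weight u))
           (sym (*-∑ (w x) us _))) ⟩
    ∑ xs (λ x → w x * ∑ us (λ u → E x u * weight u))
      ≡⟨ ∑-cong xs (λ x → cong (w x *_)
           (trans (∑-cong us λ u → *-∑ (E x u) xs _) (∑-swap us xs _))) ⟩
    ∑ xs (λ x → w x * ∑ xs (λ y → ∑ us (λ u → E x u * (w y * E y u))))
      ≡⟨ ∑-cong xs (λ x → cong (w x *_) (∑-cong xs λ y →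
           trans (∑-cong us λ u → rearrange (E x u) (w y) (E y u)) (sym (*-∑ (w y) us _)))) ⟩
    ∑ xs (λ x → w x * ∑ xs (λ y → w y * ∑ us (λ u → E x u * E y u))) ∎
    where
    open ≡-Reasoning
    open +-*-Solver
    rearrange : ∀ a b c → a * (b * c) ≡ b * (a * c)
    rearrange = solve 3 (λ a b c → a :* (b :* c) := b :* (a :* c)) refl

  -- Chebyshev's inequality for `weight`, whose mean is W / q: on the support of v
  -- it deviates from the mean by W / q, so ∑ v * W² ≤ ∑ (q * weight - W)².  The
  -- subtraction is avoided by keeping the cross term on the left.
  avoidance-bound : ∀ q p →
    length us ≡ q * (q * q) →
    (∀ x → w x * ∑ us (E x) ≡ w x * (q * q)) →
    (∀ x → w x * ∑ xs (λ y → w y * ∑ us (λ u → E x u * E y u)) ≤ w x * (q * W + q * p)) →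
    (∀ u → v u ≡ 0 ⊎ v u ≡ 1 × weight u ≡ 0) →
    .{{NonZero W}} → ∑ us v * W ≤ q * (q * q) * p
  avoidance-bound q p length≡ regular pairs avoid =
    *-cancelʳ-≤ (∑ us v * W) (q * (q * q) * p) W
      (+-cancelʳ-≤ (2 * (q * W * (W * (q * q)))) _ _ total)
    where
    open ≤-Reasoning
    open +-*-Solver

    pointwise : ∀ u → v u * (W * W) + 2 * (q * W) * weight u ≤ q * q * (weight u * weight u) + W * W
    pointwise u with avoid u
    -- Off the support of `v` this is (q * weight u - W)² ≥ 0; on it `weight u` vanishes and both
    -- sides equal W².
    ... | inj₁ v≡0 rewrite v≡0 = begin
      2 * (q * W) * weight u   ≡⟨ solve 3 (λ q W n → con 2 :* (q :* W) :* n := con 2 :* (q :* n :* W)) refl q W (weight u) ⟩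
      2 * (q * weight u * W)   ≤⟨ 2mn≤m²+n² (q * weight u) W ⟩
      q * weight u * (q * weight u) + W * W
        ≡⟨ solve 3 (λ q W n → q :* n :* (q :* n) :+ W :* W := q :* q :* (n :* n) :+ W :* W) refl q W (weight u) ⟩
      q * q * (weight u * weight u) + W * W ∎
    ... | inj₂ (v≡1 , n≡0) rewrite v≡1 | n≡0 = ≤-reflexive
      (solve 2 (λ q W → con 1 :* (W :* W) :+ con 2 :* (q :* W) :* con 0 := q :* q :* con 0 :+ W :* W) refl q W)

    ∑-weight²≤ : ∑ us (λ u → weight u * weight u) ≤ W * (q * W + q * p)
    ∑-weight²≤ = begin
      ∑ us (λ u → weight u * weight u)   ≡⟨ ∑-weight² ⟩
      _                                  ≤⟨ ∑-mono xs pairs ⟩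
      ∑ xs (λ x → w x * (q * W + q * p)) ≡⟨ ∑-* xs w _ ⟨
      W * (q * W + q * p)                ∎

    total : ∑ us v * W * W + 2 * (q * W * (W * (q * q))) ≤
      q * (q * q) * p * W + 2 * (q * W * (W * (q * q)))
    total = begin
      ∑ us v * W * W + 2 * (q * W * (W * (q * q)))
        ≡⟨ solve 3 (λ M W q → M :* W :* W :+ con 2 :* (q :* W :* (W :* (q :* q)))
             := M :* (W :* W) :+ con 2 :* (q :* W) :* (W :* (q :* q))) refl (∑ us v) W q ⟩
      ∑ us v * (W * W) + 2 * (q * W) * (W * (q * q))
        ≡⟨ cong (λ s → ∑ us v * (W * W) + 2 * (q * W) * s) (∑-weight (q * q) regular) ⟨
      ∑ us v * (W * W) + 2 * (q * W) * ∑ us weight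
        ≡⟨ cong₂ _+_ (∑-* us v (W * W)) (*-∑ (2 * (q * W)) us weight) ⟩
      ∑ us (λ u → v u * (W * W)) + ∑ us (λ u → 2 * (q * W) * weight u)
        ≡⟨ ∑-+ us _ _ ⟨
      ∑ us (λ u → v u * (W * W) + 2 * (q * W) * weight u)
        ≤⟨ ∑-mono us pointwise ⟩
      ∑ us (λ u → q * q * (weight u * weight u) + W * W)
        ≡⟨ ∑-+ us _ _ ⟩
      ∑ us (λ u → q * q * (weight u * weight u)) + ∑ us (λ _ → W * W)
        ≡⟨ cong₂ _+_ (sym (*-∑ (q * q) us _)) (trans (∑-const us (W * W)) (cong (_* (W * W)) length≡)) ⟩
      q * q * ∑ us (λ u → weight u * weight u) + q * (q * q) * (W * W)
        ≤⟨ +-monoˡ-≤ _ (*-monoʳ-≤ (q * q) ∑-weight²≤) ⟩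
      q * q * (W * (q * W + q * p)) + q * (q * q) * (W * W)
        -- The pair bound and the constant term each contribute q³W², which together make up the
        -- cross term.
        ≡⟨ solve 3 (λ q W p → q :* q :* (W :* (q :* W :+ q :* p)) :+ q :* (q :* q) :* (W :* W)
             := q :* (q :* q) :* p :* W :+ con 2 :* (q :* W :* (W :* (q :* q)))) refl q W p ⟩
      q * (q * q) * p * W + 2 * (q * W * (W * (q * q))) ∎

-- The numerical contradiction.

-- The left side is k + 3k²m + 3k³m² + k⁴m³. Since k² ≤ m, its terms are at most m², 3m², 2m⁴ and
-- m⁵, the first strictly; `4 ≤ m` bounds 4m² by m³, and m³ + 2m⁴ + m⁵ is the right side.
size-estimate : ∀ k m → 2 ≤ k → k * k ≤ m →
  k * ((1 + k * m) * ((1 + k * m) * (1 + k * m))) < m * (m * m) * ((1 + m) * (1 + m))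
size-estimate k m 2≤k s≤m = begin-strict
  k * ((1 + k * m) * ((1 + k * m) * (1 + k * m)))
    ≡⟨ solve 2 (λ k m → k :* ((con 1 :+ k :* m) :* ((con 1 :+ k :* m) :* (con 1 :+ k :* m)))
         := k :+ con 3 :* (k :* k :* m) :+ con 3 :* k :* (k :* k) :* (m :* m)
              :+ k :* k :* (k :* k) :* (m :* (m :* m))) refl k m ⟩
  k + 3 * (k * k * m) + 3 * k * (k * k) * (m * m) + k * k * (k * k) * (m * (m * m))
    <⟨ +-mono-<-≤ (+-mono-<-≤ (+-mono-<-≤ k<mm (*-monoʳ-≤ 3 (*-monoˡ-≤ m s≤m)))
         (*-monoˡ-≤ (m * m) (*-mono-≤ 3k≤2m s≤m))) (*-monoˡ-≤ (m * (m * m)) (*-mono-≤ s≤m s≤m)) ⟩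
  m * m + 3 * (m * m) + 2 * m * m * (m * m) + m * m * (m * (m * m))
    ≡⟨ solve 1 (λ m → m :* m :+ con 3 :* (m :* m) :+ con 2 :* m :* m :* (m :* m) :+ m :* m :* (m :* (m :* m))
         := con 4 :* (m :* m) :+ (con 2 :* m :* m :* (m :* m) :+ m :* m :* (m :* (m :* m)))) refl m ⟩
  4 * (m * m) + (2 * m * m * (m * m) + m * m * (m * (m * m)))
    ≤⟨ +-monoˡ-≤ _ (*-monoˡ-≤ (m * m) 4≤m) ⟩
  m * (m * m) + (2 * m * m * (m * m) + m * m * (m * (m * m)))
    ≡⟨ solve 1 (λ m → m :* (m :* m) :+ (con 2 :* m :* m :* (m :* m) :+ m :* m :* (m :* (m :* m)))
         := m :* (m :* m) :* ((con 1 :+ m) :* (con 1 :+ m))) refl m ⟩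
  m * (m * m) * ((1 + m) * (1 + m)) ∎
  where
  open ≤-Reasoning
  open +-*-Solver
  4≤m : 4 ≤ m
  4≤m = ≤-trans (*-mono-≤ 2≤k 2≤k) s≤m
  2k≤m : 2 * k ≤ m
  2k≤m = ≤-trans (*-monoˡ-≤ k 2≤k) s≤m
  3k≤2m : 3 * k ≤ 2 * m
  3k≤2m = begin
    3 * k       ≤⟨ *-monoˡ-≤ k (n≤1+n 3) ⟩
    4 * k       ≡⟨ *-assoc 2 2 k ⟩
    2 * (2 * k) ≤⟨ *-monoʳ-≤ 2 2k≤m ⟩
    2 * m       ∎
  k<mm : k < m * m
  k<mm = begin-strict
    k     <⟨ m<m*n k 2 {{>-nonZero (≤-trans (s≤s z≤n) 2≤k)}} ≤-refl ⟩
    k * 2 ≡⟨ *-comm k 2 ⟩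
    2 * k ≤⟨ 2k≤m ⟩
    m     ≤⟨ m≤m*n m m {{>-nonZero (≤-trans (s≤s z≤n) 4≤m)}} ⟩
    m * m ∎

-- Indicators of decidable propositions.

⟦_⟧ : Dec A → ℕ
⟦ yes _ ⟧ = 1
⟦ no  _ ⟧ = 0

⟦⟧-mono : (a? : Dec A) (b? : Dec B) → (A → B) → ⟦ a? ⟧ ≤ ⟦ b? ⟧
⟦⟧-mono (yes a) (yes b) f = ≤-refl
⟦⟧-mono (yes a) (no ¬b) f = ⊥-elim (¬b (f a))
⟦⟧-mono (no ¬a) b?      f = z≤n

⟦⟧-cong : (a? : Dec A) (b? : Dec B) → (A → B) → (B → A) → ⟦ a? ⟧ ≡ ⟦ b? ⟧
⟦⟧-cong a? b? f g = ≤-antisym (⟦⟧-mono a? b? f) (⟦⟧-mono b? a? g)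

⟦⟧≤1 : (a? : Dec A) → ⟦ a? ⟧ ≤ 1
⟦⟧≤1 (yes _) = ≤-refl
⟦⟧≤1 (no  _) = z≤n

⟦⟧-true : (a? : Dec A) → A → ⟦ a? ⟧ ≡ 1
⟦⟧-true (yes _) a = refl
⟦⟧-true (no ¬a) a = ⊥-elim (¬a a)

⟦⟧-false : (a? : Dec A) → ¬ A → ⟦ a? ⟧ ≡ 0
⟦⟧-false (yes a) ¬a = ⊥-elim (¬a a)
⟦⟧-false (no _)  ¬a = refl

⟦⟧-× : (a? : Dec A) (b? : Dec B) → ⟦ a? ×-dec b? ⟧ ≡ ⟦ a? ⟧ * ⟦ b? ⟧
⟦⟧-× (yes a) (yes b) = refl
⟦⟧-× (yes a) (no ¬b) = refl
⟦⟧-× (no ¬a) b?      = refl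

∑-tabulate-zero : ∀ {n} (g : Fin n → A) (f : A → ℕ) →
  (∀ i → f (g i) ≡ 0) → ∑ (tabulate g) f ≡ 0
∑-tabulate-zero {n = zero}  g f fg≡0 = refl
∑-tabulate-zero {n = suc n} g f fg≡0 = cong₂ _+_ (fg≡0 zero) (∑-tabulate-zero (g ∘ suc) f (fg≡0 ∘ suc))

∑-tabulate-single : ∀ {n} (g : Fin n → A) (f : A → ℕ) j →
  f (g j) ≡ 1 → (∀ i → i ≢ j → f (g i) ≡ 0) → ∑ (tabulate g) f ≡ 1
∑-tabulate-single g f zero    fgj≡1 fgi≡0 =
  cong₂ _+_ fgj≡1 (∑-tabulate-zero (g ∘ suc) f λ i → fgi≡0 (suc i) λ ())
∑-tabulate-single g f (suc j) fgj≡1 fgi≡0 =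
  cong₂ _+_ (fgi≡0 zero λ ()) (∑-tabulate-single (g ∘ suc) f j fgj≡1
    λ i i≢j → fgi≡0 (suc i) (i≢j ∘ Fin.suc-injective))

-- Arithmetic and exhaustive search in a finite field.

module Field {c ℓ₁ ℓ₂ q} (F : FiniteField c ℓ₁ ℓ₂ q) where

  open FiniteField F public
    using (Carrier; _≈_; _≉_; 0#; 1#; -_; setoid; commutativeSemiring; enumeration)
    renaming ( _+_ to _⊕_; _*_ to _⊗_; _-_ to _⊖_; _^_ to _↑_
             ; refl to ≈-refl; sym to ≈-sym; trans to ≈-trans )
  module F = FiniteField F
  open Inverse enumeration using (to; from; from-cong; strictlyInverseˡ; strictlyInverseʳ)
  open HeytingField F.heytingField using (tight; #⇒invertible; heytingCommutativeRing)
  open HeytingCommutativeRingProperties heytingCommutativeRing using (1#0; x-0≈x)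
  open RingProperties F.ring using (x∙y⁻¹≈ε⇒x≈y; +-cancelˡ)
  open Exp commutativeSemiring using (^-congˡ; ^-distrib-*)

  infix 4 _≟_

  _≟_ : ∀ x y → Dec (x ≈ y)
  x ≟ y = map′
    (λ eq → ≈-trans (≈-sym (strictlyInverseˡ x)) (≈-trans (F.reflexive (cong to eq)) (strictlyInverseˡ y)))
    from-cong (from x Fin.≟ from y)

  -- The search runs over the representatives `to i`; `resp` carries a given witness `x` to its
  -- representative `to (from x)`.
  any? : ∀ {p} {P : Carrier → Set p} → (∀ {x y} → x ≈ y → P x → P y) →
    (∀ x → Dec (P x)) → Dec (∃[ x ] P x)
  any? resp P? = map′ (λ (i , p) → to i , p)
    (λ (x , p) → from x , resp (≈-sym (strictlyInverseˡ x)) p) (Fin.any? (P? ∘ to))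

  elements : List Carrier
  elements = tabulate to

  length-elements : length elements ≡ q
  length-elements = length-tabulate to

  ∑-≟ : ∀ s → ∑ elements (λ t → ⟦ t ≟ s ⟧) ≡ 1
  ∑-≟ s = ∑-tabulate-single to _ (from s) (⟦⟧-true (_ ≟ s) (strictlyInverseˡ s))
    λ i i≢ → ⟦⟧-false (to i ≟ s) λ eq → i≢ (trans (sym (strictlyInverseʳ i)) (from-cong eq))

  ∑-1 : ∑ elements (λ _ → 1) ≡ q
  ∑-1 = trans (∑-const elements 1) (trans (*-identityʳ _) length-elements)

  -- The inverse is found by search. If there were none, `x` could not be apart from `0#`, and
  -- tightness would give `x ≈ 0#`.
  inverse : ∀ {x} → x ≉ 0# → ∃[ y ] x ⊗ y ≈ 1#
  inverse {x} x≉0 with any? (λ y≈z xy≈1 → ≈-trans (F.*-congˡ (≈-sym y≈z)) xy≈1) (λ y → x ⊗ y ≟ 1#)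
  ... | yes p   = p
  ... | no  ¬p  = ⊥-elim (x≉0 (proj₁ (tight x 0#) λ x#0 →
    let (y , _ , [x-0]y≈1) = #⇒invertible x#0
    in ¬p (y , ≈-trans (F.*-congʳ (≈-sym (x-0≈x x))) [x-0]y≈1)))

  1≉0 : 1# ≉ 0#
  1≉0 1≈0 = proj₂ (tight 1# 0#) 1≈0 1#0

  ⊗-cancelʳ : ∀ {x y z} → z ≉ 0# → x ⊗ z ≈ y ⊗ z → x ≈ y
  ⊗-cancelʳ {x} {y} {z} z≉0 xz≈yz = let (z⁻¹ , zz⁻¹≈1) = inverse z≉0 in begin
    x               ≈⟨ F.*-identityʳ x ⟨
    x ⊗ 1#          ≈⟨ F.*-congˡ zz⁻¹≈1 ⟨
    x ⊗ (z ⊗ z⁻¹)   ≈⟨ F.*-assoc x z z⁻¹ ⟨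
    x ⊗ z ⊗ z⁻¹     ≈⟨ F.*-congʳ xz≈yz ⟩
    y ⊗ z ⊗ z⁻¹     ≈⟨ F.*-assoc y z z⁻¹ ⟩
    y ⊗ (z ⊗ z⁻¹)   ≈⟨ F.*-congˡ zz⁻¹≈1 ⟩
    y ⊗ 1#          ≈⟨ F.*-identityʳ y ⟩
    y               ∎
    where open ≈-Reasoning setoid

  ⊗-nonzero : ∀ {x y} → x ≉ 0# → y ≉ 0# → x ⊗ y ≉ 0#
  ⊗-nonzero {x} {y} x≉0 y≉0 xy≈0 = x≉0 (⊗-cancelʳ y≉0 (≈-trans xy≈0 (≈-sym (F.zeroˡ y))))

  ↑-nonzero : ∀ {x} n → x ≉ 0# → x ↑ n ≉ 0#
  ↑-nonzero zero    x≉0 = 1≉0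
  ↑-nonzero (suc n) x≉0 = ⊗-nonzero x≉0 (↑-nonzero n x≉0)

  -- Roots of monic polynomials.

  -- The entries are the coefficients of a monic polynomial in increasing degree,
  -- the leading coefficient 1 being omitted.
  eval : ∀ {n} → Vec Carrier n → Carrier → Carrier
  eval []       x = 1#
  eval (a ∷ as) x = a ⊕ x ⊗ eval as x

  -- Horner's scheme: the coefficients of (p(X) - p(r)) / (X - r) are the values at `r` of the
  -- nonempty proper tails of `p`, the leading 1 being omitted again.
  quotient : ∀ {n} → Vec Carrier (suc n) → Carrier → Vec Carrier n
  quotient (a ∷ [])     r = []
  quotient (a ∷ b ∷ bs) r = eval (b ∷ bs) r ∷ quotient (b ∷ bs) r

  -- p(x) - p(r) = (x - r) g(x), where g is the quotient, with the negative terms moved across.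
  synthetic-division : ∀ {n} (p : Vec Carrier (suc n)) r x →
    eval p x ⊕ r ⊗ eval (quotient p r) x ≈ x ⊗ eval (quotient p r) x ⊕ eval p r
  synthetic-division (a ∷ []) r x =
    solve 3 (λ a r x → (a :+ x :* con 1) :+ r :* con 1 := x :* con 1 :+ (a :+ r :* con 1)) F.refl a r x
    where open SemiringSolver commutativeSemiring
  synthetic-division (a ∷ p@(_ ∷ _)) r x = begin
    a ⊕ x ⊗ eval p x ⊕ r ⊗ (eval p r ⊕ x ⊗ g)
      ≈⟨ solve 6 (λ a x px r pr g → a :+ x :* px :+ r :* (pr :+ x :* g)
           := a :+ x :* (px :+ r :* g) :+ r :* pr) F.refl a x (eval p x) r (eval p r) g ⟩
    a ⊕ x ⊗ (eval p x ⊕ r ⊗ g) ⊕ r ⊗ eval p r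
      ≈⟨ F.+-congʳ (F.+-congˡ (F.*-congˡ (synthetic-division p r x))) ⟩
    a ⊕ x ⊗ (x ⊗ g ⊕ eval p r) ⊕ r ⊗ eval p r
      ≈⟨ solve 5 (λ a x r pr g → a :+ x :* (x :* g :+ pr) :+ r :* pr
           := x :* (pr :+ x :* g) :+ (a :+ r :* pr)) F.refl a x r (eval p r) g ⟩
    x ⊗ (eval p r ⊕ x ⊗ g) ⊕ (a ⊕ r ⊗ eval p r) ∎
    where
    open SemiringSolver commutativeSemiring
    open ≈-Reasoning setoid
    g : Carrier
    g = eval (quotient p r) x

  eval-cong : ∀ {n} (p : Vec Carrier n) {x y} → x ≈ y → eval p x ≈ eval p y
  eval-cong []      x≈y = ≈-refl
  eval-cong (a ∷ p) x≈y = F.+-congˡ (F.*-cong x≈y (eval-cong p x≈y))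

  -- Induction on the degree: once a root `r` is found, every root is `r` or a root of the quotient
  -- by X - r.
  root-count : ∀ {n} (p : Vec Carrier n) → ∑ elements (λ x → ⟦ eval p x ≟ 0# ⟧) ≤ n
  root-count [] = ≤-reflexive (∑-tabulate-zero to _ λ i → ⟦⟧-false (1# ≟ 0#) 1≉0)
  root-count {suc n} p
    with any? (λ x≈y px≈0 → ≈-trans (eval-cong p (≈-sym x≈y)) px≈0) (λ x → eval p x ≟ 0#)
  ... | no ¬root = ≤-trans (≤-reflexive (∑-tabulate-zero to _ λ i →
    ⟦⟧-false (eval p (to i) ≟ 0#) (¬root ∘ (to i ,_)))) z≤n
  ... | yes (r , pr≈0) = begin
    ∑ elements (λ x → ⟦ eval p x ≟ 0# ⟧)                                 ≤⟨ ∑-mono elements pointwise ⟩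
    ∑ elements (λ x → ⟦ x ≟ r ⟧ + ⟦ eval (quotient p r) x ≟ 0# ⟧)        ≡⟨ ∑-+ elements _ _ ⟩
    ∑ elements (λ x → ⟦ x ≟ r ⟧) + ∑ elements (λ x → ⟦ eval (quotient p r) x ≟ 0# ⟧)
      ≤⟨ +-mono-≤ (≤-reflexive (∑-≟ r)) (root-count (quotient p r)) ⟩
    suc n                                                                ∎
    where
    open ≤-Reasoning
    pointwise : ∀ x → ⟦ eval p x ≟ 0# ⟧ ≤ ⟦ x ≟ r ⟧ + ⟦ eval (quotient p r) x ≟ 0# ⟧
    pointwise x with eval p x ≟ 0# | eval (quotient p r) x ≟ 0#
    ... | no _      | _       = z≤n
    ... | yes _     | yes _   = m≤n+m 1 _
    ... | yes px≈0  | no qx≉0 = ≤-trans (≤-reflexive (sym (⟦⟧-true (x ≟ r) x≈r))) (m≤m+n _ 0)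
      where
      x≈r : x ≈ r
      -- With p(x) and p(r) both zero, synthetic division reads r g(x) ≈ x g(x), and g(x) cancels.
      x≈r = ⊗-cancelʳ qx≉0 (≈-trans (≈-sym (≈-trans (F.+-congˡ pr≈0) (F.+-identityʳ _)))
        (≈-trans (≈-sym (synthetic-division p r x)) (≈-trans (F.+-congʳ px≈0) (F.+-identityˡ _))))

  eval-replicate-0 : ∀ n x → eval (replicate n 0#) x ≈ x ↑ n
  eval-replicate-0 zero    x = ≈-refl
  eval-replicate-0 (suc n) x = ≈-trans (F.+-identityˡ _) (F.*-congˡ (eval-replicate-0 n x))

  -- The fibre consists of roots of the monic polynomial Xⁿ⁺¹ - a.
  power-fibre : ∀ n a → ∑ elements (λ x → ⟦ x ↑ suc n ≟ a ⟧) ≤ suc n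
  power-fibre n a = ≤-trans (∑-mono elements λ x → ⟦⟧-mono (x ↑ suc n ≟ a) (eval p x ≟ 0#)
      λ eq → ≈-trans (F.+-congˡ (≈-trans (F.*-congˡ (eval-replicate-0 n x)) eq)) (F.-‿inverseˡ a))
    (root-count p)
    where
    p : Vec Carrier (suc n)
    p = (- a) ∷ replicate n 0#

  -- Linear equations in one unknown.

  ∑-affine : ∀ {x} r a → x ≉ 0# → ∑ elements (λ t → ⟦ r ⊕ x ⊗ t ≟ a ⟧) ≡ 1
  ∑-affine {x} r a x≉0 = trans
    (∑-cong elements λ t → ⟦⟧-cong (r ⊕ x ⊗ t ≟ a) (t ≟ s) (there t) (back t)) (∑-≟ s)
    where
    open ≈-Reasoning setoid
    x⁻¹ = proj₁ (inverse x≉0)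
    xx⁻¹≈1 = proj₂ (inverse x≉0)
    s : Carrier
    s = (a ⊖ r) ⊗ x⁻¹
    xs≈a-r : x ⊗ s ≈ a ⊖ r
    xs≈a-r = begin
      x ⊗ ((a ⊖ r) ⊗ x⁻¹)  ≈⟨ F.*-comm x _ ⟩
      (a ⊖ r) ⊗ x⁻¹ ⊗ x    ≈⟨ F.*-assoc _ _ _ ⟩
      (a ⊖ r) ⊗ (x⁻¹ ⊗ x)  ≈⟨ F.*-congˡ (≈-trans (F.*-comm _ _) xx⁻¹≈1) ⟩
      (a ⊖ r) ⊗ 1#         ≈⟨ F.*-identityʳ _ ⟩
      a ⊖ r                ∎
    root : r ⊕ x ⊗ s ≈ a
    root = begin
      r ⊕ x ⊗ s        ≈⟨ F.+-congˡ xs≈a-r ⟩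
      r ⊕ (a ⊕ - r)    ≈⟨ F.+-comm r _ ⟩
      a ⊕ - r ⊕ r      ≈⟨ F.+-assoc a _ r ⟩
      a ⊕ (- r ⊕ r)    ≈⟨ F.+-congˡ (F.-‿inverseˡ r) ⟩
      a ⊕ 0#           ≈⟨ F.+-identityʳ a ⟩
      a                ∎
    there : ∀ t → r ⊕ x ⊗ t ≈ a → t ≈ s
    there t eq = ⊗-cancelʳ x≉0 (≈-trans (F.*-comm t x) (≈-trans
      (+-cancelˡ r _ _ (≈-trans eq (≈-sym root))) (F.*-comm x s)))
    back : ∀ t → t ≈ s → r ⊕ x ⊗ t ≈ a
    back t t≈s = ≈-trans (F.+-congˡ (F.*-congˡ t≈s)) root

  -- Two affine functions with different slopes agree at most at (e′ - e) / (A - B). Uniqueness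
  -- alone is asserted, as it serves upper bounds.
  crossing : ∀ {A B} e e′ → A ≉ B → ∃[ s ] (∀ t → t ⊗ A ⊕ e ≈ t ⊗ B ⊕ e′ → t ≈ s)
  crossing {A} {B} e e′ A≉B = (e′ ⊖ e) ⊗ d⁻¹ , λ t eq → ⊗-cancelʳ d≉0 (begin
    t ⊗ d                      ≈⟨ td≈ t eq ⟩
    e′ ⊖ e                     ≈⟨ F.*-identityʳ _ ⟨
    (e′ ⊖ e) ⊗ 1#              ≈⟨ F.*-congˡ (≈-trans (F.*-comm _ _) dd⁻¹≈1) ⟨
    (e′ ⊖ e) ⊗ (d⁻¹ ⊗ d)       ≈⟨ F.*-assoc _ _ _ ⟨
    (e′ ⊖ e) ⊗ d⁻¹ ⊗ d         ∎)
    where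
    open ≈-Reasoning setoid
    d : Carrier
    d = A ⊖ B
    d≉0 : d ≉ 0#
    d≉0 d≈0 = A≉B (x∙y⁻¹≈ε⇒x≈y A B d≈0)
    d⁻¹ = proj₁ (inverse d≉0)
    dd⁻¹≈1 = proj₂ (inverse d≉0)
    td≈ : ∀ t → t ⊗ A ⊕ e ≈ t ⊗ B ⊕ e′ → t ⊗ d ≈ e′ ⊖ e
    td≈ t eq = +-cancelˡ (t ⊗ B ⊕ e) _ _ (begin
      t ⊗ B ⊕ e ⊕ t ⊗ (A ⊕ - B)   ≈⟨ solve 5 (λ t A B e n → t :* B :+ e :+ t :* (A :+ n)
                                        := t :* A :+ e :+ t :* (n :+ B)) F.refl t A B e (- B) ⟩
      t ⊗ A ⊕ e ⊕ t ⊗ (- B ⊕ B)   ≈⟨ F.+-cong eq (≈-trans (F.*-congˡ (F.-‿inverseˡ B)) (F.zeroʳ t)) ⟩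
      t ⊗ B ⊕ e′ ⊕ 0#             ≈⟨ F.+-congˡ (F.-‿inverseˡ e) ⟨
      t ⊗ B ⊕ e′ ⊕ (- e ⊕ e)      ≈⟨ solve 4 (λ tB e e′ n → tB :+ e′ :+ (n :+ e)
                                        := tB :+ e :+ (e′ :+ n)) F.refl (t ⊗ B) e e′ (- e) ⟩
      t ⊗ B ⊕ e ⊕ (e′ ⊕ - e)      ∎)
      where open SemiringSolver commutativeSemiring

  -- Summation over the points of F³.

  Point : Set _
  Point = Carrier × Carrier × Carrier

  points : List Point
  points = cartesianProduct elements (cartesianProduct elements elements)

  ∑-points : (f : Point → ℕ) →
    ∑ points f ≡ ∑ elements (λ x → ∑ elements (λ y → ∑ elements (λ z → f (x , y , z))))
  ∑-points f = trans (∑-cartesianProduct elements _ f)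
    (∑-cong elements λ x → ∑-cartesianProduct elements elements (λ p → f (x , p)))

  ∑-points-separable : (f g h : Carrier → ℕ) →
    ∑ points (λ (x , y , z) → f x * (g y * h z)) ≡ ∑ elements f * (∑ elements g * ∑ elements h)
  ∑-points-separable f g h = begin
    ∑ points (λ (x , y , z) → f x * (g y * h z))
      ≡⟨ ∑-points _ ⟩
    ∑ elements (λ x → ∑ elements (λ y → ∑ elements (λ z → f x * (g y * h z))))
      ≡⟨ ∑-cong elements (λ x → trans (∑-cong elements λ y → sym (*-∑ (f x) elements _))
           (sym (*-∑ (f x) elements _))) ⟩
    ∑ elements (λ x → f x * ∑ elements (λ y → ∑ elements (λ z → g y * h z)))
      ≡⟨ ∑-* elements f _ ⟨
    ∑ elements f * ∑ elements (λ y → ∑ elements (λ z → g y * h z))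
      ≡⟨ cong (∑ elements f *_) (trans (∑-cong elements λ y → sym (*-∑ (g y) elements h))
           (sym (∑-* elements g _))) ⟩
    ∑ elements f * (∑ elements g * ∑ elements h) ∎
    where open ≡-Reasoning

  infix 4 _≋_ _≋?_
  _≋_ : Point → Point → Set _
  (x , y , z) ≋ (x′ , y′ , z′) = x ≈ x′ × y ≈ y′ × z ≈ z′

  _≋?_ : ∀ p p′ → Dec (p ≋ p′)
  (x , y , z) ≋? (x′ , y′ , z′) = (x ≟ x′) ×-dec ((y ≟ y′) ×-dec (z ≟ z′))

  ∑-≋? : ∀ p → ∑ points (λ p′ → ⟦ p ≋? p′ ⟧) ≡ 1
  ∑-≋? (x , y , z) = begin
    ∑ points (λ (x′ , y′ , z′) → ⟦ (x , y , z) ≋? (x′ , y′ , z′) ⟧)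
      ≡⟨ ∑-cong points (λ (x′ , y′ , z′) →
           trans (⟦⟧-× (x ≟ x′) _) (cong (⟦ x ≟ x′ ⟧ *_) (⟦⟧-× (y ≟ y′) (z ≟ z′)))) ⟩
    ∑ points (λ (x′ , y′ , z′) → ⟦ x ≟ x′ ⟧ * (⟦ y ≟ y′ ⟧ * ⟦ z ≟ z′ ⟧))
      ≡⟨ ∑-points-separable _ _ _ ⟩
    ∑ elements (λ t → ⟦ x ≟ t ⟧) * (∑ elements (λ t → ⟦ y ≟ t ⟧) * ∑ elements (λ t → ⟦ z ≟ t ⟧))
      ≡⟨ cong₂ _*_ (single x) (cong₂ _*_ (single y) (single z)) ⟩
    1 ∎
    where
    open ≡-Reasoning
    single : ∀ x → ∑ elements (λ t → ⟦ x ≟ t ⟧) ≡ 1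
    single x = trans (∑-cong elements λ t → ⟦⟧-cong (x ≟ t) (t ≟ x) ≈-sym ≈-sym) (∑-≟ x)

  length-points : length points ≡ q * (q * q)
  length-points = begin
    length points                ≡⟨ *-identityʳ _ ⟨
    length points * 1            ≡⟨ ∑-const points 1 ⟨
    ∑ points (λ _ → 1)           ≡⟨ ∑-points-separable (λ _ → 1) (λ _ → 1) (λ _ → 1) ⟩
    ∑ elements (λ _ → 1) * (∑ elements (λ _ → 1) * ∑ elements (λ _ → 1))
                                 ≡⟨ cong (λ n → n * (n * n)) ∑-1 ⟩
    q * (q * q)                  ∎
    where open ≡-Reasoning

  infix 7 _∙_
  _∙_ : Point → Point → Carrier
  (x , y , z) ∙ (r , s , t) = x ⊗ r ⊕ y ⊗ s ⊕ z ⊗ t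

  -- Degrees and codegrees of the incidence x ∙ u = a.

  module Incidence (a : Carrier) (a≉0 : a ≉ 0#) where

    E : Point → Point → ℕ
    E x u = ⟦ x ∙ u ≟ a ⟧

    -- The coordinates `r` and `s` are free, and `t` is then determined because `z` is invertible.
    degree : ∀ x y {z} → z ≉ 0# → ∑ points (E (x , y , z)) ≡ q * q
    degree x y {z} z≉0 = begin
      ∑ points (E (x , y , z))
        ≡⟨ ∑-points _ ⟩
      ∑ elements (λ r → ∑ elements (λ s → ∑ elements (λ t → E (x , y , z) (r , s , t))))
        ≡⟨ ∑-cong elements (λ r → trans (∑-cong elements λ s → ∑-affine (x ⊗ r ⊕ y ⊗ s) a z≉0) ∑-1) ⟩
      ∑ elements (λ _ → q)
        ≡⟨ trans (∑-const elements q) (cong (_* q) length-elements) ⟩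
      q * q ∎
      where open ≡-Reasoning

    -- The line is parametrised by `r`: the indicator forces `s` to be `s₀ r`, and `e r s` has total
    -- mass 1 over `t`.
    ∑-line : (f e : Carrier → Carrier → Carrier → ℕ) (s₀ : Carrier → Carrier) →
      (∀ r s → ∑ elements (e r s) ≡ 1) → (∀ r s t → f r s t ≤ ⟦ s ≟ s₀ r ⟧ * e r s t) →
      ∑ elements (λ r → ∑ elements (λ s → ∑ elements (f r s))) ≤ q
    ∑-line f e s₀ ∑e≡1 f≤ = begin
      ∑ elements (λ r → ∑ elements (λ s → ∑ elements (f r s)))
        ≤⟨ ∑-mono elements (λ r → ∑-mono elements λ s → ∑-mono elements (f≤ r s)) ⟩
      ∑ elements (λ r → ∑ elements (λ s → ∑ elements (λ t → ⟦ s ≟ s₀ r ⟧ * e r s t)))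
        ≡⟨ ∑-cong elements (λ r → ∑-cong elements λ s →
             trans (sym (*-∑ ⟦ s ≟ s₀ r ⟧ elements (e r s)))
                   (trans (cong (⟦ s ≟ s₀ r ⟧ *_) (∑e≡1 r s)) (*-identityʳ _))) ⟩
      ∑ elements (λ r → ∑ elements (λ s → ⟦ s ≟ s₀ r ⟧))
        ≡⟨ trans (∑-cong elements λ r → ∑-≟ (s₀ r)) ∑-1 ⟩
      q ∎
      where open ≤-Reasoning

    E*E≤ : ∀ x x′ u {s s₀} → (x ∙ u ≈ a → x′ ∙ u ≈ a → s ≈ s₀) → E x u * E x′ u ≤ ⟦ s ≟ s₀ ⟧ * E x u
    E*E≤ x x′ u {s} {s₀} s≈s₀ with x ∙ u ≟ a | x′ ∙ u ≟ a
    ... | no _   | _      = z≤n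
    ... | yes _  | no _   = z≤n
    ... | yes xu | yes x′u rewrite ⟦⟧-true (s ≟ s₀) (s≈s₀ xu x′u) = ≤-refl

    -- Eliminating `t` leaves an equation in `r` and `s` whose coefficient of `s` is the minor yz′ -
    -- zy′. So `r` determines `s`, and then the first plane determines `t`.
    codegree-yz : ∀ x y z x′ y′ z′ → z ≉ 0# → y ⊗ z′ ≉ z ⊗ y′ →
      ∑ points (λ u → E (x , y , z) u * E (x′ , y′ , z′) u) ≤ q
    codegree-yz x y z x′ y′ z′ z≉0 minor≉0 = ≤-trans (≤-reflexive (∑-points _))
      (∑-line _ _ (λ r → proj₁ (cross r)) (λ r s → ∑-affine (x ⊗ r ⊕ y ⊗ s) a z≉0)
        (λ r s t → E*E≤ (x , y , z) (x′ , y′ , z′) (r , s , t) λ xu x′u →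
          proj₂ (cross r) s (eliminate r s t xu x′u)))
      where
      cross : ∀ r → ∃[ s₀ ] (∀ s →
        s ⊗ (y ⊗ z′) ⊕ (a ⊗ z ⊕ x ⊗ r ⊗ z′) ≈ s ⊗ (z ⊗ y′) ⊕ (a ⊗ z′ ⊕ x′ ⊗ r ⊗ z) → s ≈ s₀)
      cross r = crossing _ _ minor≉0
      -- This compares z′ times the first equation with z times the second; both contain zz′t.
      -- Negative terms are moved across.
      eliminate : ∀ r s t → (x , y , z) ∙ (r , s , t) ≈ a → (x′ , y′ , z′) ∙ (r , s , t) ≈ a →
        s ⊗ (y ⊗ z′) ⊕ (a ⊗ z ⊕ x ⊗ r ⊗ z′) ≈ s ⊗ (z ⊗ y′) ⊕ (a ⊗ z′ ⊕ x′ ⊗ r ⊗ z)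
      eliminate r s t xu x′u = begin
        s ⊗ (y ⊗ z′) ⊕ (a ⊗ z ⊕ x ⊗ r ⊗ z′)
          ≈⟨ F.+-congˡ (F.+-congʳ (F.*-congʳ x′u)) ⟨
        s ⊗ (y ⊗ z′) ⊕ ((x′ ⊗ r ⊕ y′ ⊗ s ⊕ z′ ⊗ t) ⊗ z ⊕ x ⊗ r ⊗ z′)
          ≈⟨ solve 9 (λ x y z x′ y′ z′ r s t →
               s :* (y :* z′) :+ ((x′ :* r :+ y′ :* s :+ z′ :* t) :* z :+ x :* r :* z′)
               := s :* (z :* y′) :+ ((x :* r :+ y :* s :+ z :* t) :* z′ :+ x′ :* r :* z))
               F.refl x y z x′ y′ z′ r s t ⟩
        s ⊗ (z ⊗ y′) ⊕ ((x ⊗ r ⊕ y ⊗ s ⊕ z ⊗ t) ⊗ z′ ⊕ x′ ⊗ r ⊗ z)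
          ≈⟨ F.+-congˡ (F.+-congʳ (F.*-congʳ xu)) ⟩
        s ⊗ (z ⊗ y′) ⊕ (a ⊗ z′ ⊕ x′ ⊗ r ⊗ z) ∎
        where
        open ≈-Reasoning setoid
        open SemiringSolver commutativeSemiring

    -- Exchanging the first two coordinates of both vectors and of `u` reduces this to the other
    -- minor.
    codegree-xz : ∀ x y z x′ y′ z′ → z ≉ 0# → x ⊗ z′ ≉ z ⊗ x′ →
      ∑ points (λ u → E (x , y , z) u * E (x′ , y′ , z′) u) ≤ q
    codegree-xz x y z x′ y′ z′ z≉0 minor≉0 = begin
      ∑ points (λ u → E (x , y , z) u * E (x′ , y′ , z′) u)
        ≡⟨ ∑-cong points (λ u → cong₂ _*_ (swap x y z u) (swap x′ y′ z′ u)) ⟩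
      ∑ points (λ (r , s , t) → E (y , x , z) (s , r , t) * E (y′ , x′ , z′) (s , r , t))
        ≡⟨ trans (∑-points _) (trans (∑-swap elements elements _) (sym (∑-points _))) ⟩
      ∑ points (λ u → E (y , x , z) u * E (y′ , x′ , z′) u)
        ≤⟨ codegree-yz y x z y′ x′ z′ z≉0 minor≉0 ⟩
      q ∎
      where
      open ≤-Reasoning
      swap : ∀ x y z ((r , s , t) : Point) → E (x , y , z) (r , s , t) ≡ E (y , x , z) (s , r , t)
      swap x y z (r , s , t) = ⟦⟧-cong (_ ≟ a) (_ ≟ a)
        (≈-trans (F.+-congʳ (F.+-comm _ _))) (≈-trans (F.+-congʳ (F.+-comm _ _)))

    -- The vanishing minors make the two vectors proportional, and a common u with
    -- the same nonzero value a forces the factor to be 1.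
    proportional⇒≋ : ∀ x y z x′ y′ z′ u → z ≉ 0# → x ⊗ z′ ≈ z ⊗ x′ → y ⊗ z′ ≈ z ⊗ y′ →
      (x , y , z) ∙ u ≈ a → (x′ , y′ , z′) ∙ u ≈ a → (x , y , z) ≋ (x′ , y′ , z′)
    proportional⇒≋ x y z x′ y′ z′ (r , s , t) z≉0 xz≈ yz≈ xu x′u = scale xz≈ , scale yz≈ , ≈-sym z′≈z
      where
      open ≈-Reasoning setoid
      open SemiringSolver commutativeSemiring
      z′≈z : z′ ≈ z
      z′≈z = ⊗-cancelʳ a≉0 (begin
        z′ ⊗ a                                     ≈⟨ F.*-congˡ xu ⟨
        z′ ⊗ (x ⊗ r ⊕ y ⊗ s ⊕ z ⊗ t)               ≈⟨ solve 7 (λ x y z z′ r s t → z′ :* (x :* r :+ y :* s :+ z :* t)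
                                                        := x :* z′ :* r :+ y :* z′ :* s :+ z :* z′ :* t) F.refl x y z z′ r s t ⟩
        x ⊗ z′ ⊗ r ⊕ y ⊗ z′ ⊗ s ⊕ z ⊗ z′ ⊗ t       ≈⟨ F.+-congʳ (F.+-cong (F.*-congʳ xz≈) (F.*-congʳ yz≈)) ⟩
        z ⊗ x′ ⊗ r ⊕ z ⊗ y′ ⊗ s ⊕ z ⊗ z′ ⊗ t       ≈⟨ solve 7 (λ x y z z′ r s t → z :* x :* r :+ z :* y :* s :+ z :* z′ :* t
                                                        := z :* (x :* r :+ y :* s :+ z′ :* t)) F.refl x′ y′ z z′ r s t ⟩
        z ⊗ (x′ ⊗ r ⊕ y′ ⊗ s ⊕ z′ ⊗ t)             ≈⟨ F.*-congˡ x′u ⟩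
        z ⊗ a                                      ∎)
      scale : ∀ {x x′} → x ⊗ z′ ≈ z ⊗ x′ → x ≈ x′
      scale {x} {x′} eq = ⊗-cancelʳ z≉0 (≈-trans (F.*-congˡ (≈-sym z′≈z)) (≈-trans eq (F.*-comm z x′)))

    -- A nonzero minor makes the planes meet in at most a line. If both minors vanish, the planes
    -- are parallel and, the vectors being distinct, disjoint.
    codegree : ∀ x y z x′ y′ z′ → z ≉ 0# → ¬ (x , y , z) ≋ (x′ , y′ , z′) →
      ∑ points (λ u → E (x , y , z) u * E (x′ , y′ , z′) u) ≤ q
    codegree x y z x′ y′ z′ z≉0 p≉p′ with x ⊗ z′ ≟ z ⊗ x′ | y ⊗ z′ ≟ z ⊗ y′
    ... | no xz≉  | _       = codegree-xz x y z x′ y′ z′ z≉0 xz≉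
    ... | yes _   | no yz≉  = codegree-yz x y z x′ y′ z′ z≉0 yz≉
    ... | yes xz≈ | yes yz≈ = ≤-trans (≤-reflexive
        (trans (∑-cong points disjoint) (trans (∑-const points 0) (*-zeroʳ (length points))))) z≤n
      where
      disjoint : ∀ u → E (x , y , z) u * E (x′ , y′ , z′) u ≡ 0
      disjoint u with (x , y , z) ∙ u ≟ a | (x′ , y′ , z′) ∙ u ≟ a
      ... | no _   | _      = refl
      ... | yes _  | no _   = refl
      ... | yes xu | yes x′u = ⊥-elim (p≉p′ (proportional⇒≋ x y z x′ y′ z′ u z≉0 xz≈ yz≈ xu x′u))

  -- Counting k-th powers.

  module Powers (n : ℕ) where

    k : ℕ
    k = suc n

    Power NonzeroPower : Carrier → Set _
    Power x = ∃[ y ] y ↑ k ≈ x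
    NonzeroPower x = Power x × x ≉ 0#

    power? : ∀ x → Dec (Power x)
    power? x = any? (λ y≈z yk≈x → ≈-trans (^-congˡ k (≈-sym y≈z)) yk≈x) (λ y → y ↑ k ≟ x)

    nonzeroPower? : ∀ x → Dec (NonzeroPower x)
    nonzeroPower? x = power? x ×-dec ¬? (x ≟ 0#)

    m : ℕ
    m = ∑ elements (λ x → ⟦ nonzeroPower? x ⟧)

    0-power : Power 0#
    0-power = 0# , F.zeroˡ _

    ∑-power : 1 + m ≤ ∑ elements (λ x → ⟦ power? x ⟧)
    ∑-power = begin
      1 + m                                                    ≡⟨ cong (_+ m) (∑-≟ 0#) ⟨
      ∑ elements (λ x → ⟦ x ≟ 0# ⟧) + m                        ≡⟨ ∑-+ elements _ _ ⟨
      ∑ elements (λ x → ⟦ x ≟ 0# ⟧ + ⟦ nonzeroPower? x ⟧)      ≤⟨ ∑-mono elements pointwise ⟩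
      ∑ elements (λ x → ⟦ power? x ⟧)                          ∎
      where
      open ≤-Reasoning
      pointwise : ∀ x → ⟦ x ≟ 0# ⟧ + ⟦ nonzeroPower? x ⟧ ≤ ⟦ power? x ⟧
      pointwise x with x ≟ 0# | power? x
      ... | yes _   | yes _  = ≤-refl
      ... | yes x≈0 | no ¬p  = ⊥-elim (¬p (0# , ≈-trans (proj₂ 0-power) (≈-sym x≈0)))
      ... | no _    | yes _  = ≤-refl
      ... | no _    | no _   = ≤-refl

    -- Every element is zero or lies in the fibre of the power map over some nonzero power, and each
    -- of these `m` fibres has at most `k` elements.
    q≤1+km : q ≤ 1 + k * m
    q≤1+km = begin
      q
        ≡⟨ ∑-1 ⟨
      ∑ elements (λ _ → 1)
        ≤⟨ ∑-mono elements pointwise ⟩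
      ∑ elements (λ y → ⟦ y ≟ 0# ⟧ + ∑ elements (λ x → ⟦ nonzeroPower? x ⟧ * ⟦ y ↑ k ≟ x ⟧))
        ≡⟨ ∑-+ elements _ _ ⟩
      ∑ elements (λ y → ⟦ y ≟ 0# ⟧) + ∑ elements (λ y → ∑ elements (λ x → ⟦ nonzeroPower? x ⟧ * ⟦ y ↑ k ≟ x ⟧))
        ≡⟨ cong₂ _+_ (∑-≟ 0#) (∑-swap elements elements _) ⟩
      1 + ∑ elements (λ x → ∑ elements (λ y → ⟦ nonzeroPower? x ⟧ * ⟦ y ↑ k ≟ x ⟧))
        ≡⟨ cong (1 +_) (∑-cong elements λ x → sym (*-∑ ⟦ nonzeroPower? x ⟧ elements _)) ⟩
      1 + ∑ elements (λ x → ⟦ nonzeroPower? x ⟧ * ∑ elements (λ y → ⟦ y ↑ k ≟ x ⟧))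
        ≤⟨ +-monoʳ-≤ 1 (∑-mono elements λ x → *-monoʳ-≤ ⟦ nonzeroPower? x ⟧ (power-fibre n x)) ⟩
      1 + ∑ elements (λ x → ⟦ nonzeroPower? x ⟧ * k)
        ≡⟨ cong (1 +_) (trans (sym (∑-* elements _ k)) (*-comm m k)) ⟩
      1 + k * m ∎
      where
      open ≤-Reasoning
      pointwise : ∀ y → 1 ≤ ⟦ y ≟ 0# ⟧ + ∑ elements (λ x → ⟦ nonzeroPower? x ⟧ * ⟦ y ↑ k ≟ x ⟧)
      pointwise y with y ≟ 0#
      ... | yes _  = s≤s z≤n
      ... | no y≉0 = ≤-trans (≤-reflexive (sym (∑-≟ (y ↑ k)))) (∑-mono elements inner)
        where
        inner : ∀ x → ⟦ x ≟ y ↑ k ⟧ ≤ ⟦ nonzeroPower? x ⟧ * ⟦ y ↑ k ≟ x ⟧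
        inner x with x ≟ y ↑ k
        ... | no _ = z≤n
        ... | yes x≈yk = ≤-reflexive (sym (cong₂ _*_
          (⟦⟧-true (nonzeroPower? x) ((y , ≈-sym x≈yk) , λ x≈0 → ↑-nonzero k y≉0 (≈-trans (≈-sym x≈yk) x≈0)))
          (⟦⟧-true (y ↑ k ≟ x) (≈-sym x≈yk))))

    Sum : Carrier → Set _
    Sum a = ∃[ x ] ∃[ y ] ∃[ z ] a ≈ x ↑ k ⊕ y ↑ k ⊕ z ↑ k

    -- Deciding this by search permits the later argument by contradiction.
    sum? : ∀ a → Dec (Sum a)
    sum? a = any? (λ x≈x′ (y , z , eq) → y , z , ≈-trans eq (F.+-congʳ (F.+-congʳ (^-congˡ k x≈x′))))
      λ x → any? (λ y≈y′ (z , eq) → z , ≈-trans eq (F.+-congʳ (F.+-congˡ (^-congˡ k y≈y′))))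
      λ y → any? (λ z≈z′ eq → ≈-trans eq (F.+-congˡ (^-congˡ k z≈z′)))
      λ z → a ≟ x ↑ k ⊕ y ↑ k ⊕ z ↑ k

    Power-⊗ : ∀ {x y} → Power x → Power y → Power (x ⊗ y)
    Power-⊗ (r , rk≈x) (s , sk≈y) = r ⊗ s , ≈-trans (^-distrib-* r s k) (F.*-cong rk≈x sk≈y)

    Sum-⊕ : ∀ {x y z a} → Power x → Power y → Power z → x ⊕ y ⊕ z ≈ a → Sum a
    Sum-⊕ (r , rk) (s , sk) (t , tk) eq = r , s , t ,
      ≈-trans (≈-sym eq) (≈-sym (F.+-cong (F.+-cong rk sk) tk))

    -- The incidence bound for an element that is not a sum of three powers.

    module NotSum (a : Carrier) (a≉0 : a ≉ 0#) (¬sum : ¬ Sum a) where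
      open Incidence a a≉0

      -- The degree and codegree counts ask for a nonzero last coordinate; admitting 0 in the other
      -- two raises the count from m³ to (m + 1)² m.
      source? : ∀ ((x , y , z) : Point) → Dec (Power x × Power y × NonzeroPower z)
      source? (x , y , z) = power? x ×-dec (power? y ×-dec nonzeroPower? z)

      target? : ∀ ((x , y , z) : Point) → Dec (NonzeroPower x × NonzeroPower y × NonzeroPower z)
      target? (x , y , z) = nonzeroPower? x ×-dec (nonzeroPower? y ×-dec nonzeroPower? z)

      open SecondMoment points points (⟦_⟧ ∘ source?) (⟦_⟧ ∘ target?) E

      W≥ : (1 + m) * ((1 + m) * m) ≤ W
      W≥ = begin
        (1 + m) * ((1 + m) * m)
          ≤⟨ *-mono-≤ ∑-power (*-monoˡ-≤ m ∑-power) ⟩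
        ∑ elements (λ x → ⟦ power? x ⟧) * (∑ elements (λ x → ⟦ power? x ⟧) * m)
          ≡⟨ ∑-points-separable _ _ _ ⟨
        ∑ points (λ (x , y , z) → ⟦ power? x ⟧ * (⟦ power? y ⟧ * ⟦ nonzeroPower? z ⟧))
          ≡⟨ ∑-cong points (λ (x , y , z) →
               trans (⟦⟧-× (power? x) _) (cong (⟦ power? x ⟧ *_) (⟦⟧-× (power? y) _))) ⟨
        W ∎
        where open ≤-Reasoning

      ∑-target : ∑ points (⟦_⟧ ∘ target?) ≡ m * (m * m)
      ∑-target = trans (∑-cong points λ (x , y , z) →
          trans (⟦⟧-× (nonzeroPower? x) _) (cong (⟦ nonzeroPower? x ⟧ *_) (⟦⟧-× (nonzeroPower? y) _)))
        (∑-points-separable _ _ _)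

      regular : ∀ x → ⟦ source? x ⟧ * ∑ points (E x) ≡ ⟦ source? x ⟧ * (q * q)
      regular p@(x , y , z) with source? p
      ... | no _                    = refl
      ... | yes (_ , _ , _ , z≉0)   = cong (1 *_) (degree x y z≉0)

      -- Each pair is charged `q`, which suffices off the diagonal. On the diagonal the codegree is
      -- at most the degree q² = q + q * d with d = q - 1, so an excess of `q * d` is added once.
      pairs : ∀ d → q ≡ suc d → ∀ x →
        ⟦ source? x ⟧ * ∑ points (λ y → ⟦ source? y ⟧ * ∑ points (λ u → E x u * E y u)) ≤
        ⟦ source? x ⟧ * (q * W + q * d)
      pairs d q≡ p@(x , y , z) with source? p
      ... | no _                  = z≤n
      ... | yes (_ , _ , _ , z≉0) = *-monoʳ-≤ 1 (begin
        ∑ points (λ p′ → ⟦ source? p′ ⟧ * ∑ points (λ u → E p u * E p′ u))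
          ≤⟨ ∑-mono points pointwise ⟩
        ∑ points (λ p′ → q * ⟦ source? p′ ⟧ + q * d * ⟦ p ≋? p′ ⟧)
          ≡⟨ ∑-+ points _ _ ⟩
        ∑ points (λ p′ → q * ⟦ source? p′ ⟧) + ∑ points (λ p′ → q * d * ⟦ p ≋? p′ ⟧)
          ≡⟨ cong₂ _+_ (sym (*-∑ q points _)) (sym (*-∑ (q * d) points _)) ⟩
        q * W + q * d * ∑ points (λ p′ → ⟦ p ≋? p′ ⟧)
          ≡⟨ cong (q * W +_) (trans (cong (q * d *_) (∑-≋? p)) (*-identityʳ _)) ⟩
        q * W + q * d ∎)
        where
        open ≤-Reasoning
        pointwise : ∀ p′ → ⟦ source? p′ ⟧ * ∑ points (λ u → E p u * E p′ u) ≤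
          q * ⟦ source? p′ ⟧ + q * d * ⟦ p ≋? p′ ⟧
        pointwise p′@(x′ , y′ , z′) with source? p′ | p ≋? p′
        ... | no _  | _        = z≤n
        ... | yes _ | no p≉p′  = begin
          1 * ∑ points (λ u → E p u * E p′ u)  ≡⟨ *-identityˡ _ ⟩
          ∑ points (λ u → E p u * E p′ u)      ≤⟨ codegree x y z x′ y′ z′ z≉0 p≉p′ ⟩
          q                                    ≡⟨ *-identityʳ q ⟨
          q * 1                                ≤⟨ m≤m+n (q * 1) _ ⟩
          q * 1 + q * d * 0                    ∎
        ... | yes _ | yes _    = begin
          1 * ∑ points (λ u → E p u * E p′ u)  ≡⟨ *-identityˡ _ ⟩
          ∑ points (λ u → E p u * E p′ u)      ≤⟨ ∑-mono points (λ u → *-monoʳ-≤ (E p u) (⟦⟧≤1 (p′ ∙ u ≟ a))) ⟩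
          ∑ points (λ u → E p u * 1)           ≡⟨ ∑-cong points (λ u → *-identityʳ (E p u)) ⟩
          ∑ points (E p)                       ≡⟨ degree x y z≉0 ⟩
          q * q                                ≡⟨ cong (q *_) q≡ ⟩
          q * (1 + d)                          ≡⟨ *-distribˡ-+ q 1 d ⟩
          q * 1 + q * d                        ≡⟨ cong (q * 1 +_) (*-identityʳ (q * d)) ⟨
          q * 1 + q * d * 1                    ∎

      -- If x ∙ u = a with `x` in the source and `u` in the target, the three products of
      -- coordinates are k-th powers with sum `a`, contrary to `¬sum`.
      avoid : ∀ u → ⟦ target? u ⟧ ≡ 0 ⊎ ⟦ target? u ⟧ ≡ 1 × weight u ≡ 0
      avoid u@(r , s , t) with target? u
      ... | no _ = inj₁ refl
      ... | yes ((R , _) , (S , _) , (T , _)) = inj₂ (refl ,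
          trans (∑-cong points vanish) (trans (∑-const points 0) (*-zeroʳ (length points))))
        where
        vanish : ∀ p → ⟦ source? p ⟧ * E p u ≡ 0
        vanish p with source? p | p ∙ u ≟ a
        ... | no _                      | _      = refl
        ... | yes _                     | no _   = refl
        ... | yes (X , Y , Z , _)       | yes eq =
          ⊥-elim (¬sum (Sum-⊕ (Power-⊗ X R) (Power-⊗ Y S) (Power-⊗ Z T) eq))

      few-powers : ∀ d → q ≡ suc d → 1 ≤ m →
        m * (m * m) * ((1 + m) * ((1 + m) * m)) ≤ q * (q * q) * d
      few-powers d q≡ 1≤m = begin
        m * (m * m) * ((1 + m) * ((1 + m) * m))  ≤⟨ *-monoʳ-≤ (m * (m * m)) W≥ ⟩
        m * (m * m) * W                          ≡⟨ cong (_* W) ∑-target ⟨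
        ∑ points (⟦_⟧ ∘ target?) * W             ≤⟨ avoidance-bound q d length-points regular (pairs d q≡) avoid ⟩
        q * (q * q) * d                          ∎
        where
        open ≤-Reasoning
        instance
          -- `1 ≤ m` makes the lower bound for `W` positive, so that `W` can be divided out.
          W≢0 : NonZero W
          W≢0 = >-nonZero (≤-trans (*-mono-≤ (s≤s (z≤n {m})) (*-mono-≤ (s≤s (z≤n {m})) 1≤m)) W≥)

    -- Conclusion.

    k³<q⇒Sum : 2 ≤ k → k * (k * k) < q → ∀ a → Sum a
    k³<q⇒Sum 2≤k k³<q a with a ≟ 0# | sum? a
    -- The incidence argument requires `a ≉ 0#`, so zero is written as 0 + 0 + 0.
    ... | yes a≈0 | _       = Sum-⊕ 0-power 0-power 0-power
      (≈-trans (F.+-identityʳ _) (≈-trans (F.+-identityʳ _) (≈-sym a≈0)))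
    ... | no _    | yes sum = sum
    ... | no a≉0  | no ¬sum = ⊥-elim (<⇒≱ (size-estimate k m 2≤k kk≤m) bound)
      where
      open NotSum a a≉0 ¬sum
      kk≤m : k * k ≤ m
      -- From k³ < q ≤ 1 + km follows k³ ≤ km.
      kk≤m = *-cancelˡ-≤ k (≤-pred (≤-trans k³<q q≤1+km))
      1≤m : 1 ≤ m
      1≤m = ≤-trans (*-mono-≤ (s≤s (z≤n {n})) (s≤s (z≤n {n}))) kk≤m
      d : ℕ
      d = pred q
      q≡ : q ≡ suc d
      q≡ = sym (suc-pred q {{>-nonZero (≤-trans (s≤s z≤n) k³<q)}})
      N : ℕ
      N = 1 + k * m
      bound : m * (m * m) * ((1 + m) * (1 + m)) ≤ k * (N * (N * N))
      bound = *-cancelʳ-≤ _ _ m {{>-nonZero 1≤m}} (begin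
        m * (m * m) * ((1 + m) * (1 + m)) * m
          ≡⟨ solve 1 (λ m → m :* (m :* m) :* ((con 1 :+ m) :* (con 1 :+ m)) :* m
               := m :* (m :* m) :* ((con 1 :+ m) :* ((con 1 :+ m) :* m))) refl m ⟩
        m * (m * m) * ((1 + m) * ((1 + m) * m))
          ≤⟨ few-powers d q≡ 1≤m ⟩
        q * (q * q) * d
          -- Three factors `q` are bounded by `N` and the factor q - 1 by `k * m`, which supplies
          -- the `m` to be cancelled.
          ≤⟨ *-mono-≤ (*-mono-≤ q≤1+km (*-mono-≤ q≤1+km q≤1+km))
               (≤-pred (≤-trans (≤-reflexive (sym q≡)) q≤1+km)) ⟩
        N * (N * N) * (k * m)
          ≡⟨ solve 3 (λ N k m → N :* (N :* N) :* (k :* m) := k :* (N :* (N :* N)) :* m) refl N k m ⟩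
        k * (N * (N * N)) * m ∎)
        where
        open ≤-Reasoning
        open +-*-Solver

theorem3p3 : ∀ {c ℓ₁ ℓ₂} (k q : ℕ) .{{_ : NonZero k}} (F : FiniteField c ℓ₁ ℓ₂ q) →
    q > k ^ 3 → (x : FiniteField.Carrier F) → FiniteField.IsSumOfThreePowers F k x
-- For k = 1, where `size-estimate` does not apply, x = x + 0 + 0.
theorem3p3 (suc zero) q F _ x = x , 0# , 0# , (begin
  x                                        ≈⟨ F.+-identityʳ x ⟨
  x ⊕ 0#                                   ≈⟨ F.+-identityʳ _ ⟨
  x ⊕ 0# ⊕ 0#                              ≈⟨ F.+-cong (F.+-cong (F.*-identityʳ x) (F.*-identityʳ 0#)) (F.*-identityʳ 0#) ⟨
  x ↑ 1 ⊕ 0# ↑ 1 ⊕ 0# ↑ 1                  ∎)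
  where
  open Field F
  open ≈-Reasoning setoid
theorem3p3 k@(suc n@(suc _)) q F k³<q = Field.Powers.k³<q⇒Sum F n (s≤s (s≤s z≤n))
  -- `k ^ 3` unfolds to `k * (k * (k * 1))`.
  (subst (_< q) (cong (λ j → k * (k * j)) (*-identityʳ k)) k³<q)
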